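{- Consider positions of Version B in which all piles have at most $3$ tokens, with $a_1$ piles of size $1$, $a_2$ piles of size $2$, and $a_3$ piles of size $3$. Such a nonempty position (i.e. $(a_1,a_2,a_3)\neq(0,0,0)$) is a $\mathcal{P}$-position if and only if one of the following holds: \begin{itemize} \item $a_1$ is even, $a_2\geq 1$, and $a_3=0$; \item $a_1$ is odd, $a_2$ is odd, and $a_3=1$; \item $a_1$ is even, $a_2$ is odd, and $a_3\geq 2$. \end{itemize} Here "even" includes $0$.
   Context: Version B is a two-player impartial game. A position consists of finitely many piles of tokens; empty piles are ignored. The players alternate turns; on a turn, a player either removes a single token from any one nonempty pile, or removes one token from each (nonempty) pile. The last player to move wins. A position is a $\mathcal{P}$-position if the player who is not about to move has a winning strategy, equivalently if none of its options (positions reachable in one move) is a $\mathcal{P}$-position; otherwise it is an $\mathcal{N}$-position. -}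

module Defs where

open import Data.List.Base using (List; []; _∷_; map; filter; length)
open import Data.List.Relation.Unary.Any using (Any)
open import Data.Nat.Base using (ℕ; suc; pred; parity; _<_)
open import Data.Nat.Properties using (_≟_)
open import Data.Parity.Base using (0ℙ; 1ℙ)
open import Relation.Binary.PropositionalEquality.Core using (_≡_)

-- The list of pile sizes.  Entries equal to 0 are allowed; they play no
-- role in the moves below, which is how empty piles are "ignored".
Position : Set
Position = List ℕ

data RemoveOne : Position → Position → Set where
  here  : ∀ {n p} → RemoveOne (suc n ∷ p) (n ∷ p)
  there : ∀ {n p q} → RemoveOne p q → RemoveOne (n ∷ p) (n ∷ q)

infix 4 _⟶_

-- In fromAll, pred leaves empty piles empty; the hypothesis rules out a
-- "pass" when there is no token left.
data _⟶_ (p : Position) : Position → Set where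
  fromOne : ∀ {q} → RemoveOne p q → p ⟶ q
  fromAll : Any (0 <_) p → p ⟶ map pred p

-- Winning strategies under normal play.  PPosition p is a winning strategy
-- for the player not about to move at p (a reply to every move), and
-- NPosition p is one for the player about to move.  Being inductive, these
-- are well-founded strategy trees, and a player with no move loses.
mutual
  data PPosition (p : Position) : Set where
    reply : (∀ {q} → p ⟶ q → NPosition q) → PPosition p

  data NPosition (p : Position) : Set where
    play : ∀ {q} → p ⟶ q → PPosition q → NPosition p

piles : ℕ → Position → ℕ
piles k p = length (filter (_≟ k) p)

Even Odd : ℕ → Set
Even n = parity n ≡ 0ℙ
Odd  n = parity n ≡ 1ℙ

{-# OPTIONS --safe #-}

-- Only the numbers a, b, c of piles of size 1, 2, 3 matter.  Removing one
-- token changes (a , b , c) to (a - 1 , b , c), (a + 1 , b - 1 , c) or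
-- (a , b + 1 , c - 1), and removing one token from each pile changes it to
-- (b , c , 0).  Call the triples in the theorem and (0 , 0 , 0) cold.  No move
-- connects two cold triples, and from every other triple a cold one is reached
-- by the move on all piles, on a pile of size 1 or on a pile of size 3.
module Submission where

open import Defs
open import Data.Bool.Base using (true; false)
open import Data.List.Base using ([]; _∷_; length; map)
open import Data.List.Properties using (filter-none; filter-reject)
open import Data.List.Relation.Binary.Permutation.Propositional
  using (_↭_; ↭-refl; ↭-sym; ↭-trans; prep; swap)
open import Data.List.Relation.Binary.Permutation.Propositional.Properties
  using (All-resp-↭; filter-↭; ↭-length)
open import Data.List.Relation.Unary.All as All using (All; []; _∷_)
open import Data.List.Relation.Unary.All.Properties using (map⁺)
open import Data.List.Relation.Unary.Any using (Any; here; there)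
open import Data.Nat.Base
  using (ℕ; zero; suc; pred; parity; _≡ᵇ_; _≤_; _≥_; _<_; z≤n; s≤s; z<s)
open import Data.Nat.Induction using (Acc; acc; <-wellFounded)
open import Data.Nat.ListAction using (sum)
open import Data.Nat.Properties
  using (_≟_; <⇒≢; <⇒≤; ≤-refl; ≤-trans; pred[n]≤n;
         +-monoʳ-<; +-monoʳ-≤; +-mono-≤; +-mono-≤-<)
open import Data.Parity.Base using (0ℙ; 1ℙ)
open import Data.Product.Base using (_×_; _,_; ∃-syntax; ∃₂)
open import Data.Sum.Base using (_⊎_; inj₁; inj₂)
open import Function.Base using (_∘_; id)
open import Function.Bundles using (_⇔_; mk⇔)
open import Relation.Binary.PropositionalEquality.Core
  using (_≡_; refl; sym; trans; cong; subst)
open import Relation.Nullary.Decidable.Core using (yes; no)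
open import Relation.Nullary.Negation.Core using (¬_; contradiction)

parity-alternates : ∀ n → ¬ parity n ≡ parity (suc n)
parity-alternates (suc (suc n)) = parity-alternates n

¬Even×Odd : ∀ n → Even n → ¬ Odd n
¬Even×Odd n e o with () ← trans (sym e) o

Odd-suc⇒Even : ∀ n → Odd (suc n) → Even n
Odd-suc⇒Even zero          _ = refl
Odd-suc⇒Even (suc (suc n)) o = Odd-suc⇒Even n o

data Cold : ℕ → ℕ → ℕ → Set where
  empty     : Cold 0 0 0
  no-threes : ∀ {a b} → Even a → Cold a (suc b) 0
  one-three : ∀ {a b} → Odd a → Odd b → Cold a b 1
  threes    : ∀ {a b c} → Even a → Odd b → Cold a b (suc (suc c))

Empty : ℕ → ℕ → ℕ → Set
Empty a b c = a ≡ 0 × b ≡ 0 × c ≡ 0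

-- Among cold triples the value of `c` fixes the parity of `a`: odd for `c` equal to 1, even
-- otherwise. A move that keeps `c` and shifts `a` by one therefore breaks coldness; `cold-two`
-- rests on the same fact.
cold-one : ∀ {a b c} → Cold (suc a) b c → ¬ Cold a b c
cold-one {a} (no-threes e)   (no-threes e′)   = parity-alternates a (trans e′ (sym e))
cold-one {a} (one-three o _) (one-three o′ _) = parity-alternates a (trans o′ (sym o))
cold-one {a} (threes e _)    (threes e′ _)    = parity-alternates a (trans e′ (sym e))

cold-two : ∀ {a b c} → Cold a (suc b) c → ¬ Cold (suc a) b c
cold-two {a} (no-threes e)   (no-threes e′)   = parity-alternates a (trans e (sym e′))
cold-two {a} (one-three o _) (one-three o′ _) = parity-alternates a (trans o (sym o′))
cold-two {a} (threes e _)    (threes e′ _)    = parity-alternates a (trans e (sym e′))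

-- Going from two piles of size 3 to one, or from one to none, changes the parity demanded of `a`,
-- which stays put. With more such piles `b` must be odd on both sides, yet it grows by one.
cold-three : ∀ {a b c} → Cold a b (suc c) → ¬ Cold a (suc b) c
cold-three {a}     (one-three o _) (no-threes e)   = ¬Even×Odd a e o
cold-three {a}     (threes e _)    (one-three o _) = ¬Even×Odd a e o
cold-three {b = b} (threes _ o)    (threes _ o′)   = parity-alternates b (trans o (sym o′))

-- `Cold b c 0` forces `b` to be even, and to be 0 if `c` is 0. A nonempty cold triple has `b` odd
-- if `c` is positive and `b` positive if `c` is 0.
cold-all : ∀ {a b c} → ¬ Empty a b c → Cold a b c → ¬ Cold b c 0
cold-all         nonempty empty           _             = nonempty (refl , refl , refl)
cold-all {b = b} _        (one-three _ o) (no-threes e) = ¬Even×Odd b e o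
cold-all {b = b} _        (threes _ o)    (no-threes e) = ¬Even×Odd b e o

-- Positivity with `pred` replaces successor indices because the arguments will be counts
-- `piles k p`, which do not unify with `suc`.
data Outcome (a b c : ℕ) : Set where
  cold   : Cold a b c → Outcome a b c
  all↓   : ¬ Empty a b c → Cold b c 0 → Outcome a b c
  one↓   : 0 < a → Cold (pred a) b c → Outcome a b c
  three↓ : 0 < c → Cold a (suc b) (pred c) → Outcome a b c

classify : ∀ a b c → Outcome a b c
classify zero    zero    zero = cold empty
classify (suc a) zero    zero = all↓ (λ ()) empty
classify a       (suc b) zero with parity a in pa
... | 0ℙ = cold (no-threes pa)
-- An odd `a` is nonzero, so a pile of size 1 is available.
classify (suc a) (suc b) zero | 1ℙ = one↓ z<s (no-threes (Odd-suc⇒Even a pa))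
classify a b (suc c) with parity b in pb
classify a b (suc c)       | 0ℙ = all↓ (λ ()) (no-threes pb)
classify a b (suc c)       | 1ℙ with parity a in pa
-- Lowering the only pile of size 3 leaves none and makes the number of piles of size 2 positive.
classify a b (suc zero)    | 1ℙ | 0ℙ = three↓ z<s (no-threes pa)
classify a b (suc zero)    | 1ℙ | 1ℙ = cold (one-three pa pb)
classify a b (suc (suc c)) | 1ℙ | 0ℙ = cold (threes pa pb)
classify (suc a) b (suc (suc c)) | 1ℙ | 1ℙ = one↓ z<s (threes (Odd-suc⇒Even a pa) pb)

ColdPosition : Position → Set
ColdPosition p = Cold (piles 1 p) (piles 2 p) (piles 3 p)

piles-↭ : ∀ k {p q} → p ↭ q → piles k p ≡ piles k q
piles-↭ k = ↭-length ∘ filter-↭ (_≟ k)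

ColdPosition-↭ : ∀ {p q} → p ↭ q → ColdPosition p → ColdPosition q
ColdPosition-↭ σ c rewrite piles-↭ 1 σ | piles-↭ 2 σ | piles-↭ 3 σ = c

piles-map-pred : ∀ k p → piles (suc k) (map pred p) ≡ piles (suc (suc k)) p
piles-map-pred k []          = refl
piles-map-pred k (zero ∷ p)  = piles-map-pred k p
-- This one Boolean decides both filters, since `suc n ≡ᵇ suc (suc k)` reduces to it.
piles-map-pred k (suc n ∷ p) with n ≡ᵇ suc k
... | true  = cong suc (piles-map-pred k p)
... | false = piles-map-pred k p

piles-above : ∀ {k p} → All (_< k) p → piles k p ≡ 0
piles-above {k} = cong length ∘ filter-none (_≟ k) ∘ All.map <⇒≢

-- Counts shift down by one size, and the bound makes `piles 4 p` vanish. Being an equality of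
-- types, it can be transported along in either direction.
ColdPosition-map-pred : ∀ {p} → All (_≤ 3) p →
  ColdPosition (map pred p) ≡ Cold (piles 2 p) (piles 3 p) 0
ColdPosition-map-pred {p} p≤3
  rewrite piles-map-pred 0 p | piles-map-pred 1 p | piles-map-pred 2 p
        | piles-above (All.map s≤s p≤3) = refl

-- The bound ensures that every nonempty pile is seen by one of the three counts.
Any⇒¬Empty : ∀ {p} → All (_≤ 3) p → Any (0 <_) p →
  ¬ Empty (piles 1 p) (piles 2 p) (piles 3 p)
Any⇒¬Empty (z≤n ∷ p≤3)               (there p>0) = Any⇒¬Empty p≤3 p>0
Any⇒¬Empty (s≤s z≤n ∷ _)             _           = λ ()
Any⇒¬Empty (s≤s (s≤s z≤n) ∷ _)       _           = λ ()
Any⇒¬Empty (s≤s (s≤s (s≤s z≤n)) ∷ _) _           = λ ()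

¬Empty⇒Any : ∀ p → ¬ Empty (piles 1 p) (piles 2 p) (piles 3 p) → Any (0 <_) p
¬Empty⇒Any []          nonempty = contradiction (refl , refl , refl) nonempty
¬Empty⇒Any (zero ∷ p)  nonempty = there (¬Empty⇒Any p nonempty)
¬Empty⇒Any (suc n ∷ p) _        = here z<s

-- Bringing the changed pile to the front lets the counts before and after the move compute over a
-- common rest `r`.
RemoveOne⇒↭ : ∀ {p q} → RemoveOne p q →
  ∃₂ λ k r → p ↭ suc k ∷ r × q ↭ k ∷ r
RemoveOne⇒↭ here = _ , _ , ↭-refl , ↭-refl
RemoveOne⇒↭ (there {n} m) with k , r , σ , τ ← RemoveOne⇒↭ m =
  k , n ∷ r , ↭-trans (prep n σ) (swap n (suc k) ↭-refl)
            , ↭-trans (prep n τ) (swap n k ↭-refl)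

remove-from : ∀ k p → 0 < piles (suc k) p →
  ∃₂ λ q r → RemoveOne p q × p ↭ suc k ∷ r × q ↭ k ∷ r
remove-from k (n ∷ p) pos with n ≟ suc k
... | yes refl = k ∷ p , p , here , ↭-refl , ↭-refl
... | no n≢1+k
  with q , r , m , σ , τ ← remove-from k p
         (subst (0 <_) (cong length (filter-reject (_≟ suc k) n≢1+k)) pos)
  = n ∷ q , n ∷ r , there m , ↭-trans (prep n σ) (swap n (suc k) ↭-refl)
                            , ↭-trans (prep n τ) (swap n k ↭-refl)

cold-RemoveOne : ∀ {p q} → All (_≤ 3) p → RemoveOne p q →
  ColdPosition p → ¬ ColdPosition q
cold-RemoveOne p≤3 m cp cq with k , r , σ , τ ← RemoveOne⇒↭ m
  with All-resp-↭ σ p≤3 | ColdPosition-↭ σ cp | ColdPosition-↭ τ cq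
-- The bound on the front pile leaves sizes 1, 2 and 3; for each, the counts reduce to the triples
-- of the matching lemma.
... | s≤s z≤n ∷ _             | cp′ | cq′ = cold-one cp′ cq′
... | s≤s (s≤s z≤n) ∷ _       | cp′ | cq′ = cold-two cp′ cq′
... | s≤s (s≤s (s≤s z≤n)) ∷ _ | cp′ | cq′ = cold-three cp′ cq′

cold-move : ∀ {p q} → All (_≤ 3) p → p ⟶ q → ColdPosition p → ¬ ColdPosition q
cold-move p≤3 (fromOne m)   cp cq = cold-RemoveOne p≤3 m cp cq
cold-move p≤3 (fromAll p>0) cp cq =
  cold-all (Any⇒¬Empty p≤3 p>0) cp (subst id (ColdPosition-map-pred p≤3) cq)

cold-or-move-to-cold : ∀ p → All (_≤ 3) p →
  ColdPosition p ⊎ ∃[ q ] p ⟶ q × ColdPosition q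
cold-or-move-to-cold p p≤3 with classify (piles 1 p) (piles 2 p) (piles 3 p)
... | cold cp = inj₁ cp
... | all↓ nonempty c =
  inj₂ (_ , fromAll (¬Empty⇒Any p nonempty)
          , subst id (sym (ColdPosition-map-pred p≤3)) c)
... | one↓ pos c with q , r , m , σ , τ ← remove-from 0 p pos
  -- Once the counts are those of `1 ∷ r`, the `pred` in the type of `c` computes and `c` proves
  -- `ColdPosition (0 ∷ r)`.
  rewrite piles-↭ 1 σ | piles-↭ 2 σ | piles-↭ 3 σ
  = inj₂ (q , fromOne m , ColdPosition-↭ (↭-sym τ) c)
... | three↓ pos c with q , r , m , σ , τ ← remove-from 2 p pos
  rewrite piles-↭ 1 σ | piles-↭ 2 σ | piles-↭ 3 σ
  = inj₂ (q , fromOne m , ColdPosition-↭ (↭-sym τ) c)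

RemoveOne-bounded : ∀ {b p q} → RemoveOne p q → All (_≤ b) p → All (_≤ b) q
RemoveOne-bounded here      (n<b ∷ p≤b) = <⇒≤ n<b ∷ p≤b
RemoveOne-bounded (there m) (n≤b ∷ p≤b) = n≤b ∷ RemoveOne-bounded m p≤b

⟶-bounded : ∀ {b p q} → p ⟶ q → All (_≤ b) p → All (_≤ b) q
⟶-bounded (fromOne m) = RemoveOne-bounded m
⟶-bounded (fromAll _) = map⁺ ∘ All.map (≤-trans pred[n]≤n)

sum-RemoveOne : ∀ {p q} → RemoveOne p q → sum q < sum p
sum-RemoveOne here          = ≤-refl
sum-RemoveOne (there {n} m) = +-monoʳ-< n (sum-RemoveOne m)

sum-map-pred-≤ : ∀ p → sum (map pred p) ≤ sum p
sum-map-pred-≤ []      = z≤n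
sum-map-pred-≤ (n ∷ p) = +-mono-≤ (pred[n]≤n {n}) (sum-map-pred-≤ p)

sum-map-pred-< : ∀ {p} → Any (0 <_) p → sum (map pred p) < sum p
sum-map-pred-< {suc n ∷ p} (here _)    = s≤s (+-monoʳ-≤ n (sum-map-pred-≤ p))
sum-map-pred-< {n ∷ p}     (there p>0) = +-mono-≤-< (pred[n]≤n {n}) (sum-map-pred-< p>0)

sum-⟶ : ∀ {p q} → p ⟶ q → sum q < sum p
sum-⟶ (fromOne m)   = sum-RemoveOne m
sum-⟶ (fromAll p>0) = sum-map-pred-< p>0

mutual
  -- The two strategies call each other one move later; accessibility of the total number of tokens
  -- makes this terminate.
  cold⇒PPosition : ∀ {p} → Acc _<_ (sum p) → All (_≤ 3) p → ColdPosition p → PPosition p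
  cold⇒PPosition (acc rs) p≤3 cp = reply λ m →
    ¬cold⇒NPosition (rs (sum-⟶ m)) (⟶-bounded m p≤3) (cold-move p≤3 m cp)

  ¬cold⇒NPosition : ∀ {p} → Acc _<_ (sum p) → All (_≤ 3) p → ¬ ColdPosition p → NPosition p
  ¬cold⇒NPosition {p} (acc rs) p≤3 ¬cp with cold-or-move-to-cold p p≤3
  ... | inj₁ cp           = contradiction cp ¬cp
  ... | inj₂ (q , m , cq) = play m (cold⇒PPosition (rs (sum-⟶ m)) (⟶-bounded m p≤3) cq)

-- The two strategies are played against each other, swapping roles after each move; as inductive
-- trees they cannot go on forever.
¬PPosition×NPosition : ∀ {p} → PPosition p → ¬ NPosition p
¬PPosition×NPosition (reply f) (play m P) = ¬PPosition×NPosition P (f m)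

PPosition⇒cold : ∀ {p} → All (_≤ 3) p → PPosition p → ColdPosition p
PPosition⇒cold {p} p≤3 P with cold-or-move-to-cold p p≤3
... | inj₁ cp           = cp
... | inj₂ (q , m , cq) = contradiction
  (play m (cold⇒PPosition (<-wellFounded _) (⟶-bounded m p≤3) cq))
  (¬PPosition×NPosition P)

lemma2p7 : ∀ (p : Position) (a₁ a₂ a₃ : ℕ) →
    All (_≤ 3) p →
    piles 1 p ≡ a₁ → piles 2 p ≡ a₂ → piles 3 p ≡ a₃ →
    ¬ (a₁ ≡ 0 × a₂ ≡ 0 × a₃ ≡ 0) →
    PPosition p ⇔
    ( (Even a₁ × a₂ ≥ 1 × a₃ ≡ 0)
    ⊎ (Odd a₁ × Odd a₂ × a₃ ≡ 1)
    ⊎ (Even a₁ × Odd a₂ × a₃ ≥ 2) )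
lemma2p7 p _ _ _ p≤3 refl refl refl nonempty =
  mk⇔ (conditions nonempty ∘ PPosition⇒cold p≤3)
      (cold⇒PPosition (<-wellFounded _) p≤3 ∘ cold-if)
  where
  Conditions : ℕ → ℕ → ℕ → Set
  Conditions a b c =
      (Even a × b ≥ 1 × c ≡ 0)
    ⊎ (Odd a × Odd b × c ≡ 1)
    ⊎ (Even a × Odd b × c ≥ 2)

  conditions : ∀ {a b c} → ¬ Empty a b c → Cold a b c → Conditions a b c
  -- The empty position is cold but meets none of the three conditions.
  conditions ne empty           = contradiction (refl , refl , refl) ne
  conditions _  (no-threes e)   = inj₁ (e , z<s , refl)
  conditions _  (one-three o u) = inj₂ (inj₁ (o , u , refl))
  conditions _  (threes e o)    = inj₂ (inj₂ (e , o , s≤s z<s))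

  cold-if : ∀ {a b c} → Conditions a b c → Cold a b c
  cold-if (inj₁ (e , s≤s _ , refl))           = no-threes e
  cold-if (inj₂ (inj₁ (o , u , refl)))        = one-three o u
  cold-if (inj₂ (inj₂ (e , o , s≤s (s≤s _)))) = threes e o
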